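{- (Kleene Theorem.) Let $L\subseteq\mathrm{GS}$. The following are equivalent: (1) $L=[\![e]\!]$ for some GKAT expression $e\in\mathrm{Exp}$. (2) $L=\ell^{\mathcal{X}}(\iota)$ for some well-nested, finite-state $G$-automaton $\mathcal{X}$ with initial state $\iota$.
   Context: Syntax. Fix disjoint nonempty sets $\Sigma$ (actions) and $T=\{t_1,\dots,t_n\}$ (primitive tests), $T$ finite. Boolean expressions $b,c\in\mathrm{BExp}$ are generated by $0 \mid 1 \mid t\in T \mid b\cdot c \mid b+c \mid \overline{b}$. GKAT expressions $e,f\in\mathrm{Exp}$ are generated by $p\in\Sigma \mid b\in\mathrm{BExp} \mid e\cdot f \mid e+_b f \mid e^{(b)}$. $\equiv_{BA}$ denotes Boolean equivalence, $b\le c$ iff $b+c\equiv_{BA}c$. $\mathrm{At}$ is the finite set of atoms (minimal nonzero elements) of the free Boolean algebra $\mathrm{BExp}/{\equiv_{BA}}$ on $T$. Language model. Guarded strings: $\mathrm{GS}=\mathrm{At}\cdot(\Sigma\cdot\mathrm{At})^*$. Fusion product: $x\alpha\diamond\beta y = x\alpha y$ if $\alpha=\beta$, undefined otherwise; for $L,K\subseteq\mathrm{GS}$, $L\diamond K=\{x\diamond y : x\in L,y\in K, x\diamond y\text{ defined}\}$; $L^0=\mathrm{At}$, $L^{n+1}=L^n\diamond L$. For $B\subseteq\mathrm{At}$, $\overline{B}=\mathrm{At}\setminus B$, $L+_BK=(B\diamond L)\cup(\overline{B}\diamond K)$, $L^{(B)}=\bigcup_{n\ge0}(B\diamond L)^n\diamond\overline{B}$.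 Then $[\![-]\!]:\mathrm{Exp}\to 2^{\mathrm{GS}}$ is: $[\![p]\!]=\{\alpha p\beta:\alpha,\beta\in\mathrm{At}\}$, $[\![b]\!]=\{\alpha\in\mathrm{At}:\alpha\le b\}$, $[\![e\cdot f]\!]=[\![e]\!]\diamond[\![f]\!]$, $[\![e+_bf]\!]=[\![e]\!]+_{[\![b]\!]}[\![f]\!]$, $[\![e^{(b)}]\!]=[\![e]\!]^{([\![b]\!])}$. Automata. Let $GX=(2+\Sigma\times X)^{\mathrm{At}}$ with $2=\{0,1\}$. A $G$-coalgebra is a pair $\mathcal{X}=\langle X,\delta^{\mathcal{X}}\rangle$ with $\delta^{\mathcal{X}}:X\to GX$; a $G$-automaton is a $G$-coalgebra with a designated start state (and is well-nested if the underlying coalgebra is). The language $\ell^{\mathcal{X}}(s)\subseteq\mathrm{GS}$ of a state $s$ is defined inductively: $\alpha\in\ell^{\mathcal{X}}(s)$ iff $\delta^{\mathcal{X}}(s)(\alpha)=1$; $\alpha px\in\ell^{\mathcal{X}}(s)$ iff $\delta^{\mathcal{X}}(s)(\alpha)=(p,t)$ for some $t$ with $x\in\ell^{\mathcal{X}}(t)$. The coproduct $\mathcal{X}+\mathcal{Y}$ has the disjoint union $X+Y$ as states, with $\delta^{\mathcal{X}}$ on $X$ and $\delta^{\mathcal{Y}}$ on $Y$. For $Y\subseteq X$ and $h\in GX$, the uniform continuation $\mathcal{X}[Y,h]=\langle X,\delta[Y,h]\rangle$ is given by $\delta[Y,h](x)(\alpha)=h(\alpha)$ if $x\in Y$ and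 $\delta^{\mathcal{X}}(x)(\alpha)=1$, and $\delta^{\mathcal{X}}(x)(\alpha)$ otherwise. Well-nested coalgebras are defined inductively: (i) if $\mathcal{X}$ has no transitions, i.e. $\delta^{\mathcal{X}}(x)(\alpha)\in2$ for all $x,\alpha$, then $\mathcal{X}$ is well-nested; (ii) if $\mathcal{X}$ and $\mathcal{Y}$ are well-nested and $h\in G(X+Y)$, then $(\mathcal{X}+\mathcal{Y})[X,h]$ is well-nested. -}

module Defs where

open import Algebra.Lattice.Bundles using (BooleanAlgebra)
import Algebra.Lattice.Properties.BooleanAlgebra as BooleanAlgebraProperties
open import Data.Bool.Base using (Bool; true; false; _∧_; _∨_; not; if_then_else_)
import Data.Bool.Properties as Bool
open import Data.Empty using (⊥)
open import Data.Fin.Base using (Fin; zero; suc)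
open import Data.Nat.Base using (ℕ; zero; suc)
open import Data.Product using (Σ-syntax; ∃-syntax; _×_; _,_)
open import Data.Sum.Base using (_⊎_; inj₁; inj₂; [_,_]; map₂)
open import Data.Vec.Base using (Vec; []; _∷_; foldr′; lookup; tabulate)
open import Data.Vec.Properties using (tabulate∘lookup; tabulate-cong)
open import Function.Base using (const; _∘_)
open import Function.Bundles using (_↔_)
open import Level using (0ℓ)
open import Relation.Binary.PropositionalEquality
  using (_≡_; refl; cong; cong₂; subst)
  renaming (sym to ≡-sym; trans to ≡-trans)
open import Relation.Nullary using (¬_; contradiction)
open import Relation.Unary using (Pred; U; ∁; _∪_; ⋃)

-- T = {t₁,…,tₙ} is rendered as Fin n.

module Tests (n : ℕ) where

  infixr 6 _⊕_
  infixr 7 _⊙_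
  infix  4 _≡BA_ _≤BA_

  data BExp : Set where
    𝟘 𝟙     : BExp
    prim    : Fin n → BExp
    _⊙_ _⊕_ : BExp → BExp → BExp
    neg     : BExp → BExp

  data _≡BA_ : BExp → BExp → Set where
    refl  : ∀ {b} → b ≡BA b
    sym   : ∀ {b c} → b ≡BA c → c ≡BA b
    trans : ∀ {b c d} → b ≡BA c → c ≡BA d → b ≡BA d

    ⊕-cong   : ∀ {b b′ c c′} → b ≡BA b′ → c ≡BA c′ → b ⊕ c ≡BA b′ ⊕ c′
    ⊙-cong   : ∀ {b b′ c c′} → b ≡BA b′ → c ≡BA c′ → b ⊙ c ≡BA b′ ⊙ c′
    neg-cong : ∀ {b b′} → b ≡BA b′ → neg b ≡BA neg b′

    ⊕-comm  : ∀ b c → b ⊕ c ≡BA c ⊕ b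
    ⊙-comm  : ∀ b c → b ⊙ c ≡BA c ⊙ b
    ⊕-assoc : ∀ b c d → (b ⊕ c) ⊕ d ≡BA b ⊕ (c ⊕ d)
    ⊙-assoc : ∀ b c d → (b ⊙ c) ⊙ d ≡BA b ⊙ (c ⊙ d)

    ⊕-absorbs-⊙ : ∀ b c → b ⊕ (b ⊙ c) ≡BA b
    ⊙-absorbs-⊕ : ∀ b c → b ⊙ (b ⊕ c) ≡BA b

    ⊕-distribʳ-⊙ : ∀ b c d → (c ⊙ d) ⊕ b ≡BA (c ⊕ b) ⊙ (d ⊕ b)
    ⊕-distribˡ-⊙ : ∀ b c d → b ⊕ (c ⊙ d) ≡BA (b ⊕ c) ⊙ (b ⊕ d)
    ⊙-distribʳ-⊕ : ∀ b c d → (c ⊕ d) ⊙ b ≡BA (c ⊙ b) ⊕ (d ⊙ b)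
    ⊙-distribˡ-⊕ : ∀ b c d → b ⊙ (c ⊕ d) ≡BA (b ⊙ c) ⊕ (b ⊙ d)

    ⊕-complementˡ : ∀ b → neg b ⊕ b ≡BA 𝟙
    ⊕-complementʳ : ∀ b → b ⊕ neg b ≡BA 𝟙
    ⊙-complementˡ : ∀ b → neg b ⊙ b ≡BA 𝟘
    ⊙-complementʳ : ∀ b → b ⊙ neg b ≡BA 𝟘

  freeBooleanAlgebra : BooleanAlgebra 0ℓ 0ℓ
  freeBooleanAlgebra = record
    { Carrier = BExp
    ; _≈_ = _≡BA_
    ; _∨_ = _⊕_
    ; _∧_ = _⊙_
    ; ¬_  = neg
    ; ⊤   = 𝟙
    ; ⊥   = 𝟘
    ; isBooleanAlgebra = record
      { isDistributiveLattice = record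
        { isLattice = record
          { isEquivalence = record { refl = refl ; sym = sym ; trans = trans }
          ; ∨-comm = ⊕-comm ; ∨-assoc = ⊕-assoc ; ∨-cong = ⊕-cong
          ; ∧-comm = ⊙-comm ; ∧-assoc = ⊙-assoc ; ∧-cong = ⊙-cong
          ; absorptive = ⊕-absorbs-⊙ , ⊙-absorbs-⊕
          }
        ; ∨-distrib-∧ = ⊕-distribˡ-⊙ , ⊕-distribʳ-⊙
        ; ∧-distrib-∨ = ⊙-distribˡ-⊕ , ⊙-distribʳ-⊕
        }
      ; ∨-complement = ⊕-complementˡ , ⊕-complementʳ
      ; ∧-complement = ⊙-complementˡ , ⊙-complementʳ
      ; ¬-cong = neg-cong
      }
    }

  _≤BA_ : BExp → BExp → Set
  b ≤BA c = b ⊕ c ≡BA c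

  IsAtom : BExp → Set
  IsAtom b = ¬ (b ≡BA 𝟘) × (∀ c → c ≤BA b → ¬ (c ≡BA 𝟘) → c ≡BA b)

  -- An atom is an ≡BA-class of Boolean expressions.  Since there are no
  -- quotient types, At is a type of unique representatives: α stands for the
  -- class of the product ⌜ α ⌝ of literals whose i-th factor is tᵢ or its
  -- complement.  That these are exactly the atoms, each represented once, is
  -- proved below: ⌜⌝-isAtom, ⌜⌝-injective and ⌜⌝-complete.

  At : Set
  At = Vec Bool n

  literal : Bool → Fin n → BExp
  literal true  i = prim i
  literal false i = neg (prim i)

  ⨀ : ∀ {k} → Vec BExp k → BExp
  ⨀ = foldr′ _⊙_ 𝟙

  ⌜_⌝ : At → BExp
  ⌜ α ⌝ = ⨀ (tabulate λ i → literal (lookup α i) i)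

  module AtomLemmas where

    module BA where
      open BooleanAlgebra freeBooleanAlgebra public using (setoid)
      open BooleanAlgebraProperties freeBooleanAlgebra public

    import Relation.Binary.Reasoning.Setoid as SetoidReasoning
    open SetoidReasoning BA.setoid

    ≤⇒⊙ : ∀ {b c} → b ≤BA c → b ⊙ c ≡BA b
    ≤⇒⊙ {b} {c} b≤c = trans (⊙-cong refl (sym b≤c)) (⊙-absorbs-⊕ b c)

    ⊙⇒≤ : ∀ {b c} → b ⊙ c ≡BA b → b ≤BA c
    ⊙⇒≤ {b} {c} eq = begin
      b ⊕ c       ≈⟨ ⊕-comm b c ⟩
      c ⊕ b       ≈⟨ ⊕-cong refl (sym eq) ⟩
      c ⊕ (b ⊙ c) ≈⟨ ⊕-cong refl (⊙-comm b c) ⟩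
      c ⊕ (c ⊙ b) ≈⟨ ⊕-absorbs-⊙ c b ⟩
      c           ∎

    eval : BExp → At → Bool
    eval 𝟘        α = false
    eval 𝟙        α = true
    eval (prim i) α = lookup α i
    eval (b ⊙ c)  α = eval b α ∧ eval c α
    eval (b ⊕ c)  α = eval b α ∨ eval c α
    eval (neg b)  α = not (eval b α)

    eval-sound : ∀ {b c} → b ≡BA c → ∀ α → eval b α ≡ eval c α
    eval-sound refl               α = refl
    eval-sound (sym p)            α = ≡-sym (eval-sound p α)
    eval-sound (trans p q)        α = ≡-trans (eval-sound p α) (eval-sound q α)
    eval-sound (⊕-cong p q)       α = cong₂ _∨_ (eval-sound p α) (eval-sound q α)
    eval-sound (⊙-cong p q)       α = cong₂ _∧_ (eval-sound p α) (eval-sound q α)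
    eval-sound (neg-cong p)       α = cong not (eval-sound p α)
    eval-sound (⊕-comm b c)       α = Bool.∨-comm (eval b α) _
    eval-sound (⊙-comm b c)       α = Bool.∧-comm (eval b α) _
    eval-sound (⊕-assoc b c d)    α = Bool.∨-assoc (eval b α) _ _
    eval-sound (⊙-assoc b c d)    α = Bool.∧-assoc (eval b α) _ _
    eval-sound (⊕-absorbs-⊙ b c)  α = Bool.∨-abs-∧ (eval b α) (eval c α)
    eval-sound (⊙-absorbs-⊕ b c)  α = Bool.∧-abs-∨ (eval b α) (eval c α)
    eval-sound (⊕-distribʳ-⊙ b c d) α = Bool.∨-distribʳ-∧ (eval b α) (eval c α) (eval d α)
    eval-sound (⊕-distribˡ-⊙ b c d) α = Bool.∨-distribˡ-∧ (eval b α) (eval c α) (eval d α)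
    eval-sound (⊙-distribʳ-⊕ b c d) α = Bool.∧-distribʳ-∨ (eval b α) (eval c α) (eval d α)
    eval-sound (⊙-distribˡ-⊕ b c d) α = Bool.∧-distribˡ-∨ (eval b α) (eval c α) (eval d α)
    eval-sound (⊕-complementˡ b)  α = Bool.∨-inverseˡ (eval b α)
    eval-sound (⊕-complementʳ b)  α = Bool.∨-inverseʳ (eval b α)
    eval-sound (⊙-complementˡ b)  α = Bool.∧-inverseˡ (eval b α)
    eval-sound (⊙-complementʳ b)  α = Bool.∧-inverseʳ (eval b α)

    ⨀-below : ∀ {k} (f : Fin k → BExp) i → ⨀ (tabulate f) ⊙ f i ≡BA ⨀ (tabulate f)
    ⨀-below f zero = begin
      (f zero ⊙ _) ⊙ f zero ≈⟨ ⊙-comm _ _ ⟩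
      f zero ⊙ (f zero ⊙ _) ≈⟨ ⊙-assoc _ _ _ ⟨
      (f zero ⊙ f zero) ⊙ _ ≈⟨ ⊙-cong (BA.∧-idem _) refl ⟩
      f zero ⊙ _            ∎
    ⨀-below f (suc i) = trans (⊙-assoc _ _ _) (⊙-cong refl (⨀-below (f ∘ suc) i))

    eval-⨀ : ∀ {k} (f : Fin k → BExp) α → (∀ i → eval (f i) α ≡ true) →
             eval (⨀ (tabulate f)) α ≡ true
    eval-⨀ {zero}  f α all = refl
    eval-⨀ {suc k} f α all = cong₂ _∧_ (all zero) (eval-⨀ (f ∘ suc) α (all ∘ suc))

    eval-literal : ∀ α i → eval (literal (lookup α i) i) α ≡ true
    eval-literal α i with lookup α i in eq
    ... | true  = eq
    ... | false = cong not eq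

    eval-⌜⌝ : ∀ α → eval ⌜ α ⌝ α ≡ true
    eval-⌜⌝ α = eval-⨀ _ α (eval-literal α)

    scale : Bool → BExp → BExp
    scale v b = if v then b else 𝟘

    ⌜⌝-⊙ : ∀ α b → ⌜ α ⌝ ⊙ b ≡BA scale (eval b α) ⌜ α ⌝
    ⌜⌝-⊙ α 𝟘 = BA.∧-zeroʳ _
    ⌜⌝-⊙ α 𝟙 = BA.∧-identityʳ _
    ⌜⌝-⊙ α (prim i) with lookup α i | ⨀-below (λ j → literal (lookup α j) j) i
    ... | true  | below = below
    ... | false | below = begin
      ⌜ α ⌝ ⊙ prim i                  ≈⟨ ⊙-cong (sym below) refl ⟩
      (⌜ α ⌝ ⊙ neg (prim i)) ⊙ prim i ≈⟨ ⊙-assoc _ _ _ ⟩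
      ⌜ α ⌝ ⊙ (neg (prim i) ⊙ prim i) ≈⟨ ⊙-cong refl (⊙-complementˡ _) ⟩
      ⌜ α ⌝ ⊙ 𝟘                       ≈⟨ BA.∧-zeroʳ _ ⟩
      𝟘                               ∎
    ⌜⌝-⊙ α (b ⊙ c) with eval b α | ⌜⌝-⊙ α b
    ... | true  | ih = trans (sym (⊙-assoc _ _ _)) (trans (⊙-cong ih refl) (⌜⌝-⊙ α c))
    ... | false | ih = trans (sym (⊙-assoc _ _ _)) (trans (⊙-cong ih refl) (BA.∧-zeroˡ _))
    ⌜⌝-⊙ α (b ⊕ c) = trans (⊙-distribˡ-⊕ _ _ _)
      (trans (⊕-cong (⌜⌝-⊙ α b) (⌜⌝-⊙ α c)) (scale-∨ (eval b α) (eval c α)))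
      where
      scale-∨ : ∀ v w → scale v ⌜ α ⌝ ⊕ scale w ⌜ α ⌝ ≡BA scale (v ∨ w) ⌜ α ⌝
      scale-∨ true  true  = BA.∨-idem _
      scale-∨ true  false = BA.∨-identityʳ _
      scale-∨ false w     = BA.∨-identityˡ _
    ⌜⌝-⊙ α (neg b) with eval b α | ⌜⌝-⊙ α b
    ... | true  | ih = begin
      ⌜ α ⌝ ⊙ neg b       ≈⟨ ⊙-cong (sym ih) refl ⟩
      (⌜ α ⌝ ⊙ b) ⊙ neg b ≈⟨ ⊙-assoc _ _ _ ⟩
      ⌜ α ⌝ ⊙ (b ⊙ neg b) ≈⟨ ⊙-cong refl (⊙-complementʳ _) ⟩
      ⌜ α ⌝ ⊙ 𝟘           ≈⟨ BA.∧-zeroʳ _ ⟩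
      𝟘                   ∎
    ... | false | ih = begin
      ⌜ α ⌝ ⊙ neg b               ≈⟨ BA.∨-identityˡ _ ⟨
      𝟘 ⊕ (⌜ α ⌝ ⊙ neg b)         ≈⟨ ⊕-cong (sym ih) refl ⟩
      (⌜ α ⌝ ⊙ b) ⊕ (⌜ α ⌝ ⊙ neg b) ≈⟨ ⊙-distribˡ-⊕ _ _ _ ⟨
      ⌜ α ⌝ ⊙ (b ⊕ neg b)         ≈⟨ ⊙-cong refl (⊕-complementʳ _) ⟩
      ⌜ α ⌝ ⊙ 𝟙                   ≈⟨ BA.∧-identityʳ _ ⟩
      ⌜ α ⌝                       ∎

    ⌜⌝≢𝟘 : ∀ α → ¬ (⌜ α ⌝ ≡BA 𝟘)
    ⌜⌝≢𝟘 α eq = contradiction (≡-trans (≡-sym (eval-⌜⌝ α)) (eval-sound eq α)) λ ()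

    search : ∀ {k} (P : Vec Bool k → Bool) →
             (∃[ v ] P v ≡ true) ⊎ (∀ v → P v ≡ false)
    search {zero} P with P [] in eq
    ... | true  = inj₁ ([] , eq)
    ... | false = inj₂ λ { [] → eq }
    search {suc k} P with search (P ∘ (true ∷_)) | search (P ∘ (false ∷_))
    ... | inj₁ (v , p) | _            = inj₁ (true ∷ v , p)
    ... | inj₂ _       | inj₁ (v , p) = inj₁ (false ∷ v , p)
    ... | inj₂ p       | inj₂ q       =
      inj₂ λ { (true ∷ v) → p v ; (false ∷ v) → q v }

    disjoint-from-all : ∀ {k} (f : Fin k → Fin n) c →
      (∀ v → c ⊙ ⨀ (tabulate λ i → literal (lookup v i) (f i)) ≡BA 𝟘) → c ≡BA 𝟘
    disjoint-from-all {zero}  f c dis = trans (sym (BA.∧-identityʳ c)) (dis [])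
    disjoint-from-all {suc k} f c dis = begin
      c                                     ≈⟨ BA.∧-identityʳ c ⟨
      c ⊙ 𝟙                                 ≈⟨ ⊙-cong refl (⊕-complementʳ t) ⟨
      c ⊙ (t ⊕ neg t)                       ≈⟨ ⊙-distribˡ-⊕ _ _ _ ⟩
      (c ⊙ t) ⊕ (c ⊙ neg t)                 ≈⟨ ⊕-cong (half true) (half false) ⟩
      𝟘 ⊕ 𝟘                                 ≈⟨ BA.∨-identityʳ 𝟘 ⟩
      𝟘                                     ∎
      where
      t = prim (f zero)
      half : ∀ x → c ⊙ literal x (f zero) ≡BA 𝟘
      half x = disjoint-from-all (f ∘ suc) (c ⊙ literal x (f zero))
        λ v → trans (⊙-assoc _ _ _) (dis (x ∷ v))

  open AtomLemmas

  ⌜⌝-isAtom : ∀ α → IsAtom ⌜ α ⌝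
  ⌜⌝-isAtom α = ⌜⌝≢𝟘 α , minimal
    where
    minimal : ∀ c → c ≤BA ⌜ α ⌝ → ¬ (c ≡BA 𝟘) → c ≡BA ⌜ α ⌝
    minimal c c≤α c≢𝟘 with eval c α | trans (⊙-comm c ⌜ α ⌝) (⌜⌝-⊙ α c)
    ... | true  | eq = trans (sym (≤⇒⊙ c≤α)) eq
    ... | false | eq = contradiction (trans (sym (≤⇒⊙ c≤α)) eq) c≢𝟘

  ⌜⌝-injective : ∀ {α β} → ⌜ α ⌝ ≡BA ⌜ β ⌝ → α ≡ β
  ⌜⌝-injective {α} {β} eq =
    ≡-trans (≡-sym (tabulate∘lookup α)) (≡-trans (tabulate-cong agree) (tabulate∘lookup β))
    where
    same-eval : ∀ b → scale (eval b α) ⌜ α ⌝ ≡BA scale (eval b β) ⌜ β ⌝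
    same-eval b = trans (sym (⌜⌝-⊙ α b)) (trans (⊙-cong eq refl) (⌜⌝-⊙ β b))

    agree : ∀ i → lookup α i ≡ lookup β i
    agree i with lookup α i | lookup β i | same-eval (prim i)
    ... | true  | true  | _ = refl
    ... | true  | false | p = contradiction p (⌜⌝≢𝟘 α)
    ... | false | true  | p = contradiction (sym p) (⌜⌝≢𝟘 β)
    ... | false | false | _ = refl

  ⌜⌝-complete : ∀ b → IsAtom b → ∃[ α ] ⌜ α ⌝ ≡BA b
  ⌜⌝-complete b (b≢𝟘 , minimal) with search (eval b)
  ... | inj₁ (α , bα) = α , minimal ⌜ α ⌝ (⊙⇒≤ α⊙b) (⌜⌝≢𝟘 α)
    where
    α⊙b : ⌜ α ⌝ ⊙ b ≡BA ⌜ α ⌝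
    α⊙b = subst (λ v → ⌜ α ⌝ ⊙ b ≡BA scale v ⌜ α ⌝) bα (⌜⌝-⊙ α b)
  ... | inj₂ none = contradiction (disjoint-from-all (λ i → i) b disjoint) b≢𝟘
    where
    disjoint : ∀ α → b ⊙ ⌜ α ⌝ ≡BA 𝟘
    disjoint α = trans (⊙-comm b ⌜ α ⌝)
      (subst (λ v → ⌜ α ⌝ ⊙ b ≡BA scale v ⌜ α ⌝) (none α) (⌜⌝-⊙ α b))

module GKAT (n : ℕ) (Act : Set) where

  open Tests n public

  infixr 7 _∙_
  infixr 6 _+⟨_⟩_
  infix  8 _^⟨_⟩

  data Exp : Set where
    act     : Act → Exp
    test    : BExp → Exp
    _∙_     : Exp → Exp → Exp
    _+⟨_⟩_  : Exp → BExp → Exp → Exp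
    _^⟨_⟩   : Exp → BExp → Exp

  infixr 5 _▸_▸_

  -- ⟨ α ⟩ is the guarded string α, and α ▸ p ▸ x is αpx.
  data GS : Set where
    ⟨_⟩   : At → GS
    _▸_▸_ : At → Act → GS → GS

  first : GS → At
  first ⟨ α ⟩       = α
  first (α ▸ _ ▸ _) = α

  last : GS → At
  last ⟨ α ⟩       = α
  last (_ ▸ _ ▸ x) = last x

  -- The fusion xα ◇ βy, whose third argument says that it is defined (α = β).
  fuse : (x y : GS) → last x ≡ first y → GS
  fuse ⟨ _ ⟩       y _  = y
  fuse (α ▸ p ▸ x) y eq = α ▸ p ▸ fuse x y eq

  Language : Set₁
  Language = Pred GS 0ℓ

  infixr 7 _◇_

  _◇_ : Language → Language → Language
  (L ◇ K) z = ∃[ x ] ∃[ y ] L x × K y × Σ[ eq ∈ last x ≡ first y ] z ≡ fuse x y eq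

  -- B ⊆ At regarded as a subset of GS
  atoms : Pred At 0ℓ → Language
  atoms B ⟨ α ⟩       = B α
  atoms B (_ ▸ _ ▸ _) = ⊥

  power : Language → ℕ → Language
  power L zero    = atoms U
  power L (suc k) = power L k ◇ L

  choice : Pred At 0ℓ → Language → Language → Language
  choice B L K = (atoms B ◇ L) ∪ (atoms (∁ B) ◇ K)

  loop : Pred At 0ℓ → Language → Language
  loop B L = ⋃[ k ∶ ℕ ] (power (atoms B ◇ L) k ◇ atoms (∁ B))

  ⟦_⟧ᵇ : BExp → Pred At 0ℓ
  ⟦ b ⟧ᵇ α = ⌜ α ⌝ ≤BA b

  ⟦_⟧ : Exp → Language
  ⟦ act p ⟧      = λ x → ∃[ α ] ∃[ β ] x ≡ α ▸ p ▸ ⟨ β ⟩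
  ⟦ test b ⟧     = atoms ⟦ b ⟧ᵇ
  ⟦ e ∙ f ⟧      = ⟦ e ⟧ ◇ ⟦ f ⟧
  ⟦ e +⟨ b ⟩ f ⟧ = choice ⟦ b ⟧ᵇ ⟦ e ⟧ ⟦ f ⟧
  ⟦ e ^⟨ b ⟩ ⟧   = loop ⟦ b ⟧ᵇ ⟦ e ⟧

  -- 2 + Σ × X, where inj₁ true is acceptance (1) and inj₁ false rejection (0)
  Outcome : Set → Set
  Outcome X = Bool ⊎ (Act × X)

  G : Set → Set
  G X = At → Outcome X

  record Coalgebra : Set₁ where
    constructor coalgebra
    field
      State : Set
      δ     : State → G State

  open Coalgebra public

  data Accepts (𝒳 : Coalgebra) : State 𝒳 → GS → Set where
    stop : ∀ {s α} → δ 𝒳 s α ≡ inj₁ true → Accepts 𝒳 s ⟨ α ⟩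
    step : ∀ {s α p t x} → δ 𝒳 s α ≡ inj₂ (p , t) → Accepts 𝒳 t x →
           Accepts 𝒳 s (α ▸ p ▸ x)

  ℓ : (𝒳 : Coalgebra) → State 𝒳 → Language
  ℓ 𝒳 s = Accepts 𝒳 s

  mapOutcome : ∀ {X Y} → (X → Y) → Outcome X → Outcome Y
  mapOutcome f = map₂ λ { (p , x) → p , f x }

  infixr 6 _⊞_

  _⊞_ : Coalgebra → Coalgebra → Coalgebra
  𝒳 ⊞ 𝒴 = coalgebra (State 𝒳 ⊎ State 𝒴)
    [ (λ x α → mapOutcome inj₁ (δ 𝒳 x α)) , (λ y α → mapOutcome inj₂ (δ 𝒴 y α)) ]

  redirect : ∀ {X} → Bool → Outcome X → Outcome X → Outcome X
  redirect true (inj₁ true) o = o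
  redirect _    o           _ = o

  infix 8 _[_,,_]

  -- The subset Y ⊆ X is given by its characteristic function, as the case
  -- distinction on x ∈ Y in δ[Y,h] has to be decidable.
  _[_,,_] : (𝒳 : Coalgebra) → (State 𝒳 → Bool) → G (State 𝒳) → Coalgebra
  𝒳 [ Y ,, h ] = coalgebra (State 𝒳) λ x α → redirect (Y x) (δ 𝒳 x α) (h α)

  left : ∀ {X Y : Set} → X ⊎ Y → Bool
  left = [ const true , const false ]

  data WellNested : Coalgebra → Set₁ where
    no-transitions : ∀ {𝒳} → (∀ x α → ∃[ o ] δ 𝒳 x α ≡ inj₁ o) → WellNested 𝒳
    continue       : ∀ {𝒳 𝒴} → WellNested 𝒳 → WellNested 𝒴 →
                     (h : G (State 𝒳 ⊎ State 𝒴)) → WellNested ((𝒳 ⊞ 𝒴) [ left ,, h ])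

  record Automaton : Set₁ where
    field
      coalg : Coalgebra
      start : State coalg

  open Automaton public

  FiniteState : Coalgebra → Set
  FiniteState 𝒳 = ∃[ k ] (State 𝒳 ↔ Fin k)

-- Both directions rest on one description of 𝒵 = (𝒳 + 𝒴)[𝒳, h]: a state x of 𝒳
-- accepts ℓ(x) ◇ E in 𝒵, where E, the language of the pseudostate h, is the
-- least K such that h, with its successors x ∈ 𝒳 read as ℓ(x) ◇ K and y ∈ 𝒴 as
-- ℓ(y), contributes only strings of K.  Since loops of expressions are least
-- fixpoints as well, an expression is turned into a well-nested coalgebra with a
-- pseudostate ι ∈ G X by Thompson's construction, and conversely E is denoted by
-- body^(b) · exit, where b selects the atoms on which h returns to 𝒳.  Sums over
-- atoms become decision trees over the primitive tests.

module Submission where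

open import Defs
open import Data.Bool.Base using (Bool; true; false; if_then_else_)
import Data.Bool.Properties as Bool
open import Data.Empty using (⊥)
open import Data.Fin.Base using (Fin; zero; suc)
open import Data.Fin.Properties using (+↔⊎; 0↔⊥; 1↔⊤)
open import Data.Nat.Base using (ℕ; zero; suc; NonZero)
open import Data.Product using (_×_; ∃-syntax; _,_; proj₁; proj₂; Σ-syntax)
open import Data.Sum.Base using (_⊎_; inj₁; inj₂; [_,_])
open import Data.Sum.Properties using (inj₁-injective)
open import Data.Sum.Function.Propositional using (_⊎-↔_)
open import Data.Unit.Base using (⊤; tt)
open import Data.Vec.Base using (Vec; []; _∷_; lookup; tabulate)
open import Data.Vec.Properties using (tabulate∘lookup)
open import Function.Base using (id; const; _∘_)
open import Function.Bundles using (_⇔_; mk⇔; Equivalence)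
open import Function.Construct.Composition using (_↔-∘_; _⇔-∘_)
open import Function.Construct.Symmetry using (↔-sym)
open import Level using (0ℓ)
open import Relation.Binary.PropositionalEquality
  using (_≡_; refl; cong; subst)
  renaming (sym to ≡-sym; trans to ≡-trans)
open import Relation.Nullary using (contradiction)
open import Relation.Unary using (Pred; U; ∁; _⊆_; _≐_)
open import Relation.Unary.Properties using (≐-sym; ≐-trans; ≐-refl)

open Equivalence using (to; from)

module Kleene (n : ℕ) (Act : Set) where

  open GKAT n Act
  open AtomLemmas using (eval; eval-sound; eval-⌜⌝; ⌜⌝-⊙; scale; ⊙⇒≤)

  -- Fusion of guarded strings

  -- The graph of the partial operation `fuse`. Matching on it takes the fused string apart, whereas
  -- an equation with `fuse x y eq` is stuck until `x` is known.
  data Fuse : GS → GS → GS → Set where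
    here  : ∀ {α y} → α ≡ first y → Fuse ⟨ α ⟩ y y
    there : ∀ {α p x y z} → Fuse x y z → Fuse (α ▸ p ▸ x) y (α ▸ p ▸ z)

  fuse⇒Fuse : ∀ x {y} (eq : last x ≡ first y) → Fuse x y (fuse x y eq)
  fuse⇒Fuse ⟨ α ⟩       eq = here eq
  fuse⇒Fuse (α ▸ p ▸ x) eq = there (fuse⇒Fuse x eq)

  Fuse⇒fuse : ∀ {x y z} → Fuse x y z → Σ[ eq ∈ last x ≡ first y ] z ≡ fuse x y eq
  Fuse⇒fuse (here eq) = eq , refl
  Fuse⇒fuse (there {α} {p} f) with eq , eq′ ← Fuse⇒fuse f = eq , cong (α ▸ p ▸_) eq′

  Fuse-first : ∀ {x y z} → Fuse x y z → first z ≡ first x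
  Fuse-first (here eq) = ≡-sym eq
  Fuse-first (there f) = refl

  Fuse-assocʳ : ∀ {x y u w z} → Fuse x y u → Fuse u w z →
                ∃[ v ] Fuse x v z × Fuse y w v
  Fuse-assocʳ (here eq) g = _ , here (≡-trans eq (≡-sym (Fuse-first g))) , g
  Fuse-assocʳ (there f) (there g) with v , f′ , g′ ← Fuse-assocʳ f g = v , there f′ , g′

  Fuse-assocˡ : ∀ {x v z y w} → Fuse x v z → Fuse y w v →
                ∃[ u ] Fuse x y u × Fuse u w z
  Fuse-assocˡ (here eq) g = _ , here (≡-trans eq (Fuse-first g)) , g
  Fuse-assocˡ (there f) g with u , f′ , g′ ← Fuse-assocˡ f g = _ , there f′ , there g′

  Fuse-identityʳ : ∀ x → Fuse x ⟨ last x ⟩ x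
  Fuse-identityʳ ⟨ α ⟩       = here refl
  Fuse-identityʳ (α ▸ p ▸ x) = there (Fuse-identityʳ x)

  Fuse-atomʳ : ∀ {x β z} → Fuse x ⟨ β ⟩ z → z ≡ x
  Fuse-atomʳ (here eq) = cong ⟨_⟩ (≡-sym eq)
  Fuse-atomʳ (there {α} {p} f) = cong (α ▸ p ▸_) (Fuse-atomʳ f)

  -- The algebra of languages

  ◇-intro : ∀ {L K x y z} → L x → K y → Fuse x y z → (L ◇ K) z
  ◇-intro Lx Ky f = _ , _ , Lx , Ky , Fuse⇒fuse f

  ◇-elim : ∀ {L K : Language} {z} → (L ◇ K) z → ∃[ x ] ∃[ y ] L x × K y × Fuse x y z
  ◇-elim (x , y , Lx , Ky , eq , refl) = x , y , Lx , Ky , fuse⇒Fuse x eq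

  ◇-mono : ∀ {L L′ K K′ : Language} → L ⊆ L′ → K ⊆ K′ → L ◇ K ⊆ L′ ◇ K′
  ◇-mono l k (x , y , Lx , Ky , eq) = x , y , l Lx , k Ky , eq

  ◇-cong : ∀ {L L′ K K′ : Language} → L ≐ L′ → K ≐ K′ → L ◇ K ≐ L′ ◇ K′
  ◇-cong (l , l′) (k , k′) = ◇-mono l k , ◇-mono l′ k′

  ◇-assocʳ : ∀ {L K M : Language} → (L ◇ K) ◇ M ⊆ L ◇ (K ◇ M)
  ◇-assocʳ LKM
    with _ , _ , LK , Mw , g ← ◇-elim LKM
    with _ , _ , Lx , Ky , f ← ◇-elim LK
    with _ , f′ , g′ ← Fuse-assocʳ f g = ◇-intro Lx (◇-intro Ky Mw g′) f′

  ◇-assocˡ : ∀ {L K M : Language} → L ◇ (K ◇ M) ⊆ (L ◇ K) ◇ M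
  ◇-assocˡ LKM
    with _ , _ , Lx , KM , f ← ◇-elim LKM
    with _ , _ , Ky , Mw , g ← ◇-elim KM
    with _ , f′ , g′ ← Fuse-assocˡ f g = ◇-intro (◇-intro Lx Ky f′) Mw g′

  ◇-identityʳ : ∀ {L : Language} → L ◇ atoms U ≐ L
  ◇-identityʳ {L} = to′ , λ {z} Lz → ◇-intro {y = ⟨ last z ⟩} Lz _ (Fuse-identityʳ z)
    where
    to′ : L ◇ atoms U ⊆ L
    to′ LU with ◇-elim LU
    ... | _ , ⟨ _ ⟩ , Lx , _ , f = subst L (≡-sym (Fuse-atomʳ f)) Lx

  atoms-◇ : ∀ {B} {L : Language} {z} → (atoms B ◇ L) z ⇔ (B (first z) × L z)
  atoms-◇ {B} {L} {z} = mk⇔ to′ λ (Bz , Lz) → ◇-intro {x = ⟨ first z ⟩} Bz Lz (here refl)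
    where
    to′ : (atoms B ◇ L) z → B (first z) × L z
    to′ BL with ◇-elim BL
    ... | ⟨ _ ⟩ , _ , Bα , Ly , here refl = Bα , Ly

  -- Guarded loops as least fixpoints

  module _ {B : Pred At 0ℓ} {L : Language} where

    private
      M : Language
      M = atoms B ◇ L

    -- `power` appends factors on the right, but unrolling a loop prepends one; associativity of
    -- fusion moves the new factor past the others.
    power-comm : ∀ k → M ◇ power M k ⊆ power M (suc k)
    power-comm zero {z} m = ◇-intro {x = ⟨ first z ⟩} _ (proj₁ ◇-identityʳ m) (here refl)
    power-comm (suc k)  m = ◇-mono (power-comm k) id (◇-assocˡ m)

    loop-done : atoms (∁ B) ⊆ loop B L
    loop-done {⟨ α ⟩} ¬B = 0 , ◇-intro {x = ⟨ α ⟩} {y = ⟨ α ⟩} _ ¬B (here refl)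

    loop-step : M ◇ loop B L ⊆ loop B L
    loop-step m with _ , _ , Mx , (k , Py) , f ← ◇-elim m =
      suc k , ◇-mono (power-comm k) id (◇-assocˡ (◇-intro Mx Py f))

    -- Since `K` absorbs `M` from the left, the factors of a power are removed one at a time,
    -- starting with the innermost. The exit language `N` is a parameter so that a loop followed by
    -- an expression is covered; `atoms U` gives the bare loop.
    loop-least : ∀ {N K : Language} → atoms (∁ B) ◇ N ⊆ K → M ◇ K ⊆ K → loop B L ◇ N ⊆ K
    loop-least {N} {K} base closed l with _ , _ , (k , Px) , Ny , f ← ◇-elim l =
      powers k (◇-mono id base (◇-assocʳ (◇-intro Px Ny f)))
      where
      powers : ∀ k → power M k ◇ K ⊆ K
      powers zero    p = proj₂ (to atoms-◇ p)
      powers (suc k) p = powers k (◇-mono id closed (◇-assocʳ p))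

  -- Semantics of tests

  -- Evaluation respects `≡BA` and makes `⌜ α ⌝` true at `α`; conversely, meeting `⌜ α ⌝` with a
  -- test true at `α` returns `⌜ α ⌝`. Membership in a test becomes a Boolean equation that can be
  -- decided.
  ⟦⟧ᵇ⇔eval : ∀ b α → ⟦ b ⟧ᵇ α ⇔ (eval b α ≡ true)
  ⟦⟧ᵇ⇔eval b α = mk⇔ sound complete
    where
    sound : ⟦ b ⟧ᵇ α → eval b α ≡ true
    sound α≤b with eval-sound α≤b α
    ... | eq rewrite eval-⌜⌝ α = ≡-sym eq
    complete : eval b α ≡ true → ⟦ b ⟧ᵇ α
    complete eq = ⊙⇒≤ (subst (λ v → ⌜ α ⌝ ⊙ b ≡BA scale v ⌜ α ⌝) eq (⌜⌝-⊙ α b))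

  ∁⟦⟧ᵇ⇔eval : ∀ b α → ∁ ⟦ b ⟧ᵇ α ⇔ (eval b α ≡ false)
  ∁⟦⟧ᵇ⇔eval b α = mk⇔
    (λ ¬b → Bool.¬-not (¬b ∘ from (⟦⟧ᵇ⇔eval b α)))
    (λ eq b≤ → contradiction (≡-trans (≡-sym eq) (to (⟦⟧ᵇ⇔eval b α) b≤)) λ ())

  ⟦+⟧ : ∀ e b f {z} → ⟦ e +⟨ b ⟩ f ⟧ z ⇔ ⟦ if eval b (first z) then e else f ⟧ z
  ⟦+⟧ e b f {z} = mk⇔ to′ from′
    where
    to′ : ⟦ e +⟨ b ⟩ f ⟧ z → ⟦ if eval b (first z) then e else f ⟧ z
    to′ (inj₁ l) with Bz , ez ← to atoms-◇ l
      rewrite to (⟦⟧ᵇ⇔eval b (first z)) Bz = ez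
    to′ (inj₂ r) with Bz , fz ← to atoms-◇ r
      rewrite to (∁⟦⟧ᵇ⇔eval b (first z)) Bz = fz
    from′ : ⟦ if eval b (first z) then e else f ⟧ z → ⟦ e +⟨ b ⟩ f ⟧ z
    from′ h with eval b (first z) in eq
    ... | true  = inj₁ (from atoms-◇ (from (⟦⟧ᵇ⇔eval b (first z)) eq , h))
    ... | false = inj₂ (from atoms-◇ (from (∁⟦⟧ᵇ⇔eval b (first z)) eq , h))

  -- Decision trees over the primitive tests

  -- ρ embeds the tests not yet decided into all of them.
  decisionTree : {A : Set} → (Fin n → A → A → A) →
                 ∀ {k} → (Fin k → Fin n) → (Vec Bool k → A) → A
  decisionTree ite {zero}  ρ f = f []
  decisionTree ite {suc k} ρ f =
    ite (ρ zero) (decisionTree ite (ρ ∘ suc) (f ∘ (true ∷_)))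
                 (decisionTree ite (ρ ∘ suc) (f ∘ (false ∷_)))

  module _ {A : Set} {ite : Fin n → A → A → A} (P : A → Set) (α : At)
           (P-ite : ∀ i a a′ → P (ite i a a′) ⇔ P (if lookup α i then a else a′)) where

    -- Every node sends `α` to the branch for its own truth value, so the path ends in the leaf that
    -- `α` labels. `P` is abstract in order to cover both truth of a test at `α` and membership of a
    -- string starting with `α`.
    decisionTree-path : ∀ {k} (ρ : Fin k → Fin n) f →
      P (decisionTree ite ρ f) ⇔ P (f (tabulate (lookup α ∘ ρ)))
    decisionTree-path {zero}  ρ f = mk⇔ id id
    decisionTree-path {suc k} ρ f = branch ⇔-∘ P-ite (ρ zero) _ _
      where
      branch : P (if lookup α (ρ zero) then decisionTree ite (ρ ∘ suc) (f ∘ (true ∷_))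
                                       else decisionTree ite (ρ ∘ suc) (f ∘ (false ∷_)))
               ⇔ P (f (tabulate (lookup α ∘ ρ)))
      branch with lookup α (ρ zero)
      ... | true  = decisionTree-path (ρ ∘ suc) (f ∘ (true ∷_))
      ... | false = decisionTree-path (ρ ∘ suc) (f ∘ (false ∷_))

    decisionTree-⇔ : ∀ f → P (decisionTree ite id f) ⇔ P (f α)
    decisionTree-⇔ f =
      subst (λ β → P (decisionTree ite id f) ⇔ P (f β)) (tabulate∘lookup α)
            (decisionTree-path id f)

  charTest : (At → Bool) → BExp
  charTest f = decisionTree (λ i b c → (prim i ⊙ b) ⊕ (neg (prim i) ⊙ c)) id
    λ α → if f α then 𝟙 else 𝟘

  charTest-⇔ : ∀ f α → ⟦ charTest f ⟧ᵇ α ⇔ (f α ≡ true)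
  charTest-⇔ f α = leaf ⇔-∘ (decisionTree-⇔ (λ b → eval b α ≡ true) α ite-⇔ _ ⇔-∘
    ⟦⟧ᵇ⇔eval (charTest f) α)
    where
    leaf : (eval (if f α then 𝟙 else 𝟘) α ≡ true) ⇔ (f α ≡ true)
    leaf with f α
    ... | true  = mk⇔ id id
    ... | false = mk⇔ id id
    ite-⇔ : ∀ i b c → (eval ((prim i ⊙ b) ⊕ (neg (prim i) ⊙ c)) α ≡ true)
                      ⇔ (eval (if lookup α i then b else c) α ≡ true)
    ite-⇔ i b c with lookup α i
    ... | true rewrite Bool.∨-identityʳ (eval b α) = mk⇔ id id
    ... | false = mk⇔ id id

  guardedSum : (At → Exp) → Exp
  guardedSum = decisionTree (λ i e f → e +⟨ prim i ⟩ f) id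

  guardedSum-⇔ : ∀ f {z} → ⟦ guardedSum f ⟧ z ⇔ ⟦ f (first z) ⟧ z
  guardedSum-⇔ f {z} =
    decisionTree-⇔ (λ e → ⟦ e ⟧ z) (first z) (λ i e e′ → ⟦+⟧ e (prim i) e′) f

  -- Pseudostates and languages of coalgebras

  -- The one-step operator of which `ℓ` is the least fixpoint, by `ℓ-unfold` and `ℓ-least`. The
  -- successor languages `S` are arbitrary so that candidate solutions can be compared with `ℓ`.
  behaviour : ∀ {X} → (X → Language) → G X → Language
  behaviour S g ⟨ α ⟩       = g α ≡ inj₁ true
  behaviour S g (α ▸ p ▸ x) = ∃[ t ] g α ≡ inj₂ (p , t) × S t x

  module _ {X : Set} where

    behaviour-mono : ∀ {S S′ : X → Language} {g} → (∀ t → S t ⊆ S′ t) →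
                     behaviour S g ⊆ behaviour S′ g
    behaviour-mono S⊆S′ {⟨ _ ⟩}     eq             = eq
    behaviour-mono S⊆S′ {_ ▸ _ ▸ _} (t , eq , Stx) = t , eq , S⊆S′ t Stx

    behaviour-cong : ∀ {S S′ : X → Language} {g} → (∀ t → S t ≐ S′ t) →
                     behaviour S g ≐ behaviour S′ g
    behaviour-cong S≐S′ = behaviour-mono (proj₁ ∘ S≐S′) , behaviour-mono (proj₂ ∘ S≐S′)

    -- Only the outcome at the first atom is ever inspected, so agreement there replaces equality of
    -- functions.
    behaviour-resp : ∀ {S : X → Language} {g g′} z → g (first z) ≡ g′ (first z) →
                     behaviour S g z → behaviour S g′ z
    behaviour-resp ⟨ _ ⟩       eq b              = ≡-trans (≡-sym eq) b
    behaviour-resp (_ ▸ _ ▸ _) eq (t , eq′ , Stx) = t , ≡-trans (≡-sym eq) eq′ , Stx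

    behaviour-map : ∀ {Y} {S : Y → Language} (f : X → Y) (g : G X) →
                    behaviour S (mapOutcome f ∘ g) ≐ behaviour (S ∘ f) g
    behaviour-map {Y} {S} f g = to′ , from′
      where
      to′ : behaviour S (mapOutcome f ∘ g) ⊆ behaviour (S ∘ f) g
      to′ {⟨ α ⟩}     b with inj₁ true ← g α = refl
      to′ {α ▸ p ▸ x} (t , eq , Stx) with inj₂ (p , t) ← g α | refl ← eq = t , refl , Stx
      from′ : behaviour (S ∘ f) g ⊆ behaviour S (mapOutcome f ∘ g)
      from′ {⟨ α ⟩}     eq rewrite eq = refl
      from′ {α ▸ p ▸ x} (t , eq , Stx) rewrite eq = f t , refl , Stx

  behaviour-accept : ∀ {X} {S : X → Language} → behaviour S (const (inj₁ true)) ≐ atoms U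
  behaviour-accept = (λ { {⟨ _ ⟩} _ → _ ; {_ ▸ _ ▸ _} (_ , () , _) }) , λ { {⟨ _ ⟩} _ → refl }

  ℓ-unfold : ∀ 𝒳 s → ℓ 𝒳 s ≐ behaviour (ℓ 𝒳) (δ 𝒳 s)
  ℓ-unfold 𝒳 s =
    (λ { (stop eq) → eq ; (step eq a) → _ , eq , a }) ,
    (λ { {⟨ _ ⟩} eq → stop eq ; {_ ▸ _ ▸ _} (_ , eq , a) → step eq a })

  -- Accepting runs are finite, so induction on the run suffices.
  ℓ-least : ∀ 𝒳 {S : State 𝒳 → Language} → (∀ s → behaviour S (δ 𝒳 s) ⊆ S s) →
            ∀ s → ℓ 𝒳 s ⊆ S s
  ℓ-least 𝒳 closed s (stop eq)   = closed s eq
  ℓ-least 𝒳 closed s (step eq a) = closed s (_ , eq , ℓ-least 𝒳 closed _ a)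

  -- Languages of uniform continuations

  module Continuation (𝒳 𝒴 : Coalgebra) (h : G (State 𝒳 ⊎ State 𝒴)) where

    𝒵 : Coalgebra
    𝒵 = (𝒳 ⊞ 𝒴) [ left ,, h ]

    -- Treats a pseudostate over `𝒳` as if it were a state of `𝒳`: for `δ 𝒳 x` the result is
    -- definitionally `δ 𝒵 (inj₁ x)`.
    continueWith : G (State 𝒳) → G (State 𝒵)
    continueWith g α = redirect true (mapOutcome inj₁ (g α)) (h α)

    resume : Language → State 𝒵 → Language
    resume K = [ (λ x → ℓ 𝒳 x ◇ K) , ℓ 𝒴 ]

    resume-mono : ∀ {K K′} → K ⊆ K′ → ∀ s → resume K s ⊆ resume K′ s
    resume-mono K⊆K′ (inj₁ x) = ◇-mono id K⊆K′
    resume-mono K⊆K′ (inj₂ y) = id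

    -- What remains to be read once a state of 𝒳 has accepted.
    E : Language
    E = behaviour (ℓ 𝒵) h

    -- Where `g` accepts, `h` takes over and `closed` puts the string into `K`; where `g` moves, the
    -- split of the remaining string is extended by one step.
    behaviour-resume-⊆ : ∀ {K} → behaviour (resume K) h ⊆ K → ∀ g →
                         behaviour (resume K) (continueWith g) ⊆ behaviour (ℓ 𝒳) g ◇ K
    behaviour-resume-⊆ {K} closed g {z} b with g (first z) in eq
    behaviour-resume-⊆ {K} closed g {z} b | inj₁ true =
      ◇-intro {x = ⟨ first z ⟩} eq
        (closed (behaviour-resp {g = continueWith g} z
          (cong (λ o → redirect true (mapOutcome inj₁ o) (h (first z))) eq) b))
        (here refl)
    behaviour-resume-⊆ {K} closed g {⟨ α ⟩} b | inj₁ false rewrite eq = contradiction b λ ()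
    behaviour-resume-⊆ {K} closed g {⟨ α ⟩} b | inj₂ _ rewrite eq = contradiction b λ ()
    behaviour-resume-⊆ {K} closed g {α ▸ p ▸ z} (_ , eq′ , _) | inj₁ false
      rewrite eq = contradiction eq′ λ ()
    behaviour-resume-⊆ {K} closed g {α ▸ p ▸ z} (_ , eq′ , r) | inj₂ (q , x)
      rewrite eq with refl ← eq′ with _ , _ , a , k , f ← ◇-elim r =
      ◇-intro (x , eq , a) k (there f)

    -- Closure of `K` under `h` makes `resume K` a pre-fixpoint of the one-step operator of `𝒵`.
    ℓ𝒵⊆resume : ∀ {K} → behaviour (resume K) h ⊆ K → ∀ s → ℓ 𝒵 s ⊆ resume K s
    ℓ𝒵⊆resume {K} closed = ℓ-least 𝒵 λ where
      (inj₁ x) → ◇-mono (proj₂ (ℓ-unfold 𝒳 x)) id ∘ behaviour-resume-⊆ closed (δ 𝒳 x)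
      (inj₂ y) → proj₂ (ℓ-unfold 𝒴 y) ∘ proj₁ (behaviour-map inj₂ (δ 𝒴 y))

    resume⊆ℓ𝒵 : ∀ s → resume E s ⊆ ℓ 𝒵 s
    -- States of `𝒴` are never redirected, so runs of `𝒴` are runs of `𝒵`.
    resume⊆ℓ𝒵 (inj₂ y) = ℓ-least 𝒴
      (λ y → proj₂ (ℓ-unfold 𝒵 (inj₂ y)) ∘ proj₂ (behaviour-map inj₂ (δ 𝒴 y))) y
    resume⊆ℓ𝒵 (inj₁ x) r with _ , _ , a , Ey , f ← ◇-elim r = go a Ey f
      where
      go : ∀ {x w y z} → Accepts 𝒳 x w → E y → Fuse w y z → Accepts 𝒵 (inj₁ x) z
      -- The run in `𝒳` would accept here; in `𝒵` the outcome of `h` at this atom replaces that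
      -- acceptance.
      go {x} {y = y} (stop eq) Ey (here refl) = proj₂ (ℓ-unfold 𝒵 (inj₁ x))
        (behaviour-resp y
          (cong (λ o → redirect true (mapOutcome inj₁ o) (h (first y))) (≡-sym eq)) Ey)
      go {x} (step {α = α} eq a) Ey (there f) =
        step (cong (λ o → redirect true (mapOutcome inj₁ o) (h α)) eq) (go a Ey f)

    E-closed : behaviour (resume E) h ⊆ E
    E-closed = behaviour-mono resume⊆ℓ𝒵

    ℓ𝒵≐resume : ∀ s → ℓ 𝒵 s ≐ resume E s
    ℓ𝒵≐resume s = ℓ𝒵⊆resume E-closed s , resume⊆ℓ𝒵 s

    E-least : ∀ {K} → behaviour (resume K) h ⊆ K → E ⊆ K
    E-least closed = closed ∘ behaviour-mono (ℓ𝒵⊆resume closed)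

    behaviour-continueWith : ∀ g → behaviour (ℓ 𝒵) (continueWith g) ≐ behaviour (ℓ 𝒳) g ◇ E
    behaviour-continueWith g =
      behaviour-resume-⊆ E-closed g ∘ behaviour-mono (proj₁ ∘ ℓ𝒵≐resume) , from′
      where
      from′ : behaviour (ℓ 𝒳) g ◇ E ⊆ behaviour (ℓ 𝒵) (continueWith g)
      from′ r with ◇-elim r
      ... | _ , y , eq , Ey , here refl = behaviour-resp y
        (cong (λ o → redirect true (mapOutcome inj₁ o) (h (first y))) (≡-sym eq)) Ey
      ... | _ , y , (x , eq , a) , Ey , there {α} f =
        inj₁ x , cong (λ o → redirect true (mapOutcome inj₁ o) (h α)) eq ,
        resume⊆ℓ𝒵 (inj₁ x) (◇-intro a Ey f)

    behaviour-inj₂ : ∀ g → behaviour (ℓ 𝒵) (mapOutcome inj₂ ∘ g) ≐ behaviour (ℓ 𝒴) g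
    behaviour-inj₂ g = ≐-trans (behaviour-map inj₂ g) (behaviour-cong (ℓ𝒵≐resume ∘ inj₂))

  -- From expressions to automata

  -- ι stands for a start state outside 𝒳, so that its acceptance can be redirected
  -- independently of the states of 𝒳.
  record Realisation (L : Language) : Set₁ where
    field
      𝒳          : Coalgebra
      wellNested : WellNested 𝒳
      finite     : FiniteState 𝒳
      ι          : G (State 𝒳)
      correct    : behaviour (ℓ 𝒳) ι ≐ L

  -- The empty coalgebra serves tests, which have no successors, and fills the second summand for
  -- loops. The point accepts every atom: it ends a single action, and it is the start state whose
  -- acceptance gets redirected.
  emptyCoalgebra pointCoalgebra : Coalgebra
  emptyCoalgebra = coalgebra ⊥ λ ()
  pointCoalgebra = coalgebra ⊤ λ _ _ → inj₁ true

  emptyCoalgebra-wellNested : WellNested emptyCoalgebra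
  emptyCoalgebra-wellNested = no-transitions λ ()

  pointCoalgebra-wellNested : WellNested pointCoalgebra
  pointCoalgebra-wellNested = no-transitions λ _ _ → true , refl

  emptyCoalgebra-finite : FiniteState emptyCoalgebra
  emptyCoalgebra-finite = 0 , ↔-sym 0↔⊥

  pointCoalgebra-finite : FiniteState pointCoalgebra
  pointCoalgebra-finite = 1 , ↔-sym 1↔⊤

  ⊞-finite : ∀ 𝒳 𝒴 → FiniteState 𝒳 → FiniteState 𝒴 → FiniteState (𝒳 ⊞ 𝒴)
  ⊞-finite _ _ (_ , i) (_ , j) = _ , ↔-sym +↔⊎ ↔-∘ (i ⊎-↔ j)

  realise-test : ∀ b → Realisation ⟦ test b ⟧
  realise-test b = record
    { wellNested = emptyCoalgebra-wellNested
    ; finite     = emptyCoalgebra-finite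
    ; ι          = λ α → inj₁ (eval b α)
    ; correct    =
        (λ { {⟨ α ⟩} eq → from (⟦⟧ᵇ⇔eval b α) (inj₁-injective eq) }) ,
        (λ { {⟨ α ⟩} α≤b → cong inj₁ (to (⟦⟧ᵇ⇔eval b α) α≤b) })
    }

  realise-act : ∀ p → Realisation ⟦ act p ⟧
  realise-act p = record
    { wellNested = pointCoalgebra-wellNested
    ; finite     = pointCoalgebra-finite
    ; ι          = λ _ → inj₂ (p , tt)
    ; correct    =
        (λ { {α ▸ p ▸ ⟨ β ⟩} (_ , refl , stop _) → α , β , refl }) ,
        (λ { (_ , _ , refl) → tt , refl , stop refl })
    }

  realise-∙ : ∀ {L K} → Realisation L → Realisation K → Realisation (L ◇ K)
  realise-∙ {L} {K} RL RK = record
    { wellNested = continue RL.wellNested RK.wellNested h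
    ; finite     = ⊞-finite RL.𝒳 RK.𝒳 RL.finite RK.finite
    ; ι          = continueWith RL.ι
    ; correct    = ≐-trans (behaviour-continueWith RL.ι)
                     (◇-cong RL.correct (≐-trans (behaviour-inj₂ RK.ι) RK.correct))
    }
    where
    module RL = Realisation RL
    module RK = Realisation RK
    h : G (State RL.𝒳 ⊎ State RK.𝒳)
    -- This `h` moves only into the second summand, so `E` is the language of `RK.ι`.
    h = mapOutcome inj₂ ∘ RK.ι
    open Continuation RL.𝒳 RK.𝒳 h

  realise-+ : ∀ e b f → Realisation ⟦ e ⟧ → Realisation ⟦ f ⟧ → Realisation ⟦ e +⟨ b ⟩ f ⟧
  realise-+ e b f Re Rf = record
    { wellNested = continue Re.wellNested Rf.wellNested h
    ; finite     = ⊞-finite Re.𝒳 Rf.𝒳 Re.finite Rf.finite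
    ; ι          = ι
    ; correct    = (λ {z} → from (⟦+⟧ e b f) ∘ to (pointwise z)) ,
                   (λ {z} → from (pointwise z) ∘ to (⟦+⟧ e b f))
    }
    where
    module Re = Realisation Re
    module Rf = Realisation Rf
    -- Redirecting acceptance to acceptance is vacuous: 𝒵 behaves as the coproduct.
    h : G (State Re.𝒳 ⊎ State Rf.𝒳)
    h = const (inj₁ true)
    open Continuation Re.𝒳 Rf.𝒳 h

    ι₁ ι₂ ι : G (State 𝒵)
    ι₁ = mapOutcome inj₁ ∘ Re.ι
    ι₂ = mapOutcome inj₂ ∘ Rf.ι
    ι α = if eval b α then ι₁ α else ι₂ α

    ℓ-inj₁ : ∀ x → ℓ 𝒵 (inj₁ x) ≐ ℓ Re.𝒳 x
    ℓ-inj₁ x = ≐-trans (ℓ𝒵≐resume (inj₁ x))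
      (≐-trans (◇-cong ≐-refl behaviour-accept) ◇-identityʳ)

    ι₁-correct : behaviour (ℓ 𝒵) ι₁ ≐ ⟦ e ⟧
    ι₁-correct =
      ≐-trans (behaviour-map inj₁ Re.ι) (≐-trans (behaviour-cong ℓ-inj₁) Re.correct)

    ι₂-correct : behaviour (ℓ 𝒵) ι₂ ≐ ⟦ f ⟧
    ι₂-correct = ≐-trans (behaviour-inj₂ Rf.ι) Rf.correct

    pointwise : ∀ z → behaviour (ℓ 𝒵) ι z ⇔ ⟦ if eval b (first z) then e else f ⟧ z
    pointwise z with eval b (first z) in eq
    ... | true  = mk⇔ (proj₁ ι₁-correct ∘ behaviour-resp z ι≡ι₁)
                      (behaviour-resp z (≡-sym ι≡ι₁) ∘ proj₂ ι₁-correct)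
      where
      ι≡ι₁ : ι (first z) ≡ ι₁ (first z)
      ι≡ι₁ = cong (if_then ι₁ (first z) else ι₂ (first z)) eq
    ... | false = mk⇔ (proj₁ ι₂-correct ∘ behaviour-resp z ι≡ι₂)
                      (behaviour-resp z (≡-sym ι≡ι₂) ∘ proj₂ ι₂-correct)
      where
      ι≡ι₂ : ι (first z) ≡ ι₂ (first z)
      ι≡ι₂ = cong (if_then ι₁ (first z) else ι₂ (first z)) eq

  -- The decision before the first iteration is the same as after every later one, so the
  -- continuation `h` is also the initial pseudostate and the language is `E` itself.
  realise-loop : ∀ b {L} → Realisation L → Realisation (loop ⟦ b ⟧ᵇ L)
  realise-loop b {L} R = record
    { wellNested = continue R.wellNested emptyCoalgebra-wellNested h
    ; finite     = ⊞-finite R.𝒳 emptyCoalgebra R.finite emptyCoalgebra-finite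
    ; ι          = h
    ; correct    = E-least closed , loop-least base unroll ∘ proj₂ ◇-identityʳ
    }
    where
    module R = Realisation R

    -- An iteration that executes no action would repeat forever, hence the rejection.
    enter : Bool → Outcome (State R.𝒳) → Outcome (State R.𝒳 ⊎ ⊥)
    enter false _        = inj₁ true
    enter true  (inj₁ _) = inj₁ false
    enter true  (inj₂ o) = mapOutcome inj₁ (inj₂ o)

    h : G (State R.𝒳 ⊎ ⊥)
    h α = enter (eval b α) (R.ι α)

    open Continuation R.𝒳 emptyCoalgebra h

    K : Language
    K = loop ⟦ b ⟧ᵇ L

    closed : behaviour (resume K) h ⊆ K
    closed {⟨ α ⟩} eq with eval b α in bα
    ... | false = loop-done {x = ⟨ α ⟩} (from (∁⟦⟧ᵇ⇔eval b α) bα)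
    ... | true with R.ι α | eq
    ...   | inj₁ _ | ()
    ...   | inj₂ _ | ()
    closed {α ▸ p ▸ z} (t , eq , r) with eval b α in bα
    ... | false = contradiction eq λ ()
    ... | true with R.ι α in ια | eq
    ...   | inj₁ _       | ()
    ...   | inj₂ (_ , x) | refl with _ , _ , a , k , f ← ◇-elim r =
      loop-step (◇-intro
        (from atoms-◇ (from (⟦⟧ᵇ⇔eval b α) bα , proj₁ R.correct (x , ια , a))) k (there f))

    base : atoms (∁ ⟦ b ⟧ᵇ) ◇ atoms U ⊆ E
    base {z} r with to atoms-◇ r
    base {⟨ α ⟩} r | ¬b , _ =
      cong (λ v → enter v (R.ι α)) (to (∁⟦⟧ᵇ⇔eval b α) ¬b)

    unroll : (atoms ⟦ b ⟧ᵇ ◇ L) ◇ E ⊆ E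
    unroll r with x , y , BL , Ey , f ← ◇-elim r with bα , Lx ← to atoms-◇ BL
      with f | proj₂ R.correct Lx
    -- An iteration without actions leaves the string unchanged, so rejecting it in `enter` loses
    -- nothing.
    ... | here refl | _ = Ey
    ... | there {α} f′ | t , eq , a
      rewrite to (⟦⟧ᵇ⇔eval b α) bα | eq = inj₁ t , refl , resume⊆ℓ𝒵 (inj₁ t) (◇-intro a Ey f′)

  realise : ∀ e → Realisation ⟦ e ⟧
  realise (act p)      = realise-act p
  realise (test b)     = realise-test b
  realise (e ∙ f)      = realise-∙ (realise e) (realise f)
  realise (e +⟨ b ⟩ f) = realise-+ e b f (realise e) (realise f)
  realise (e ^⟨ b ⟩)   = realise-loop b (realise e)

  -- The pseudostate becomes a real state: a fresh point accepts on every atom and is at once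
  -- redirected to `R.ι`.
  Realisation⇒automaton : ∀ {L} → Realisation L →
    ∃[ 𝒜 ] WellNested (coalg 𝒜) × FiniteState (coalg 𝒜) × L ≐ ℓ (coalg 𝒜) (start 𝒜)
  Realisation⇒automaton R =
    record { coalg = 𝒵 ; start = inj₁ tt } ,
    continue pointCoalgebra-wellNested R.wellNested h ,
    ⊞-finite pointCoalgebra R.𝒳 pointCoalgebra-finite R.finite ,
    ≐-sym (≐-trans (ℓ-unfold 𝒵 (inj₁ tt)) (≐-trans (behaviour-inj₂ R.ι) R.correct))
    where
    module R = Realisation R
    h : G (⊤ ⊎ State R.𝒳)
    h = mapOutcome inj₂ ∘ R.ι
    open Continuation pointCoalgebra R.𝒳 h

  -- From automata to expressions

  act-◇ : ∀ {p} e {z} → ⟦ act p ∙ e ⟧ z ⇔ (∃[ α ] ∃[ y ] z ≡ α ▸ p ▸ y × ⟦ e ⟧ y)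
  act-◇ {p} e {z} = mk⇔ to′ from′
    where
    to′ : ⟦ act p ∙ e ⟧ z → ∃[ α ] ∃[ y ] z ≡ α ▸ p ▸ y × ⟦ e ⟧ y
    to′ r with ◇-elim r
    ... | _ , _ , (α , _ , refl) , ey , there (here _) = α , _ , refl , ey
    from′ : ∃[ α ] ∃[ y ] z ≡ α ▸ p ▸ y × ⟦ e ⟧ y → ⟦ act p ∙ e ⟧ z
    from′ (α , y , refl , ey) =
      ◇-intro {x = α ▸ p ▸ ⟨ first y ⟩} (α , first y , refl) ey (there (here refl))

  boolTest : Bool → BExp
  boolTest o = if o then 𝟙 else 𝟘

  ⟦boolTest⟧ : ∀ o {z} → ⟦ test (boolTest o) ⟧ z → o ≡ true × z ≡ ⟨ first z ⟩
  ⟦boolTest⟧ true  {⟨ α ⟩} _ = refl , refl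
  ⟦boolTest⟧ false {⟨ α ⟩} t = contradiction (to (⟦⟧ᵇ⇔eval 𝟘 α) t) λ ()

  ⟦boolTest⟧-true : ∀ α → ⟦ test 𝟙 ⟧ ⟨ α ⟩
  ⟦boolTest⟧-true α = from (⟦⟧ᵇ⇔eval 𝟙 α) refl

  -- No atom is checked here. The expression is meaningful only below the guards of `guardedSum`,
  -- which select the outcome at the first atom.
  outcomeExp : ∀ {X} → (X → Exp) → Outcome X → Exp
  outcomeExp s (inj₁ o)       = test (boolTest o)
  outcomeExp s (inj₂ (p , x)) = act p ∙ s x

  outcomeExp-behaviour : ∀ {X} (s : X → Exp) g {z} →
    ⟦ outcomeExp s (g (first z)) ⟧ z ⇔ behaviour (⟦_⟧ ∘ s) g z
  outcomeExp-behaviour {X} s g {z} = mk⇔ (to′ {z}) (from′ {z})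
    where
    to′ : ∀ {z} → ⟦ outcomeExp s (g (first z)) ⟧ z → behaviour (⟦_⟧ ∘ s) g z
    to′ {⟨ α ⟩} r with g α
    ... | inj₁ o with refl , _ ← ⟦boolTest⟧ o {⟨ α ⟩} r = refl
    ... | inj₂ (p , x) with () ← proj₁ (proj₂ (proj₂ (to (act-◇ (s x)) r)))
    to′ {α ▸ p ▸ z} r with g α
    ... | inj₁ o with () ← proj₂ (⟦boolTest⟧ o {α ▸ p ▸ z} r)
    ... | inj₂ (q , x) with _ , _ , refl , ez ← to (act-◇ (s x)) r = x , refl , ez
    from′ : ∀ {z} → behaviour (⟦_⟧ ∘ s) g z → ⟦ outcomeExp s (g (first z)) ⟧ z
    from′ {⟨ α ⟩}     eq            rewrite eq = ⟦boolTest⟧-true α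
    from′ {α ▸ p ▸ z} (x , eq , ez) rewrite eq = from (act-◇ (s x)) (α , z , refl , ez)

  pseudostateExp : ∀ {X} → (X → Exp) → G X → Exp
  pseudostateExp s g = guardedSum (outcomeExp s ∘ g)

  ⟦pseudostateExp⟧ : ∀ {X} (s : X → Exp) g → ⟦ pseudostateExp s g ⟧ ≐ behaviour (⟦_⟧ ∘ s) g
  ⟦pseudostateExp⟧ s g =
    to (outcomeExp-behaviour s g) ∘ to (guardedSum-⇔ _) ,
    from (guardedSum-⇔ _) ∘ from (outcomeExp-behaviour s g)

  ⟦𝟘⟧-empty : ∀ {L : Language} → ⟦ test 𝟘 ⟧ ⊆ L
  ⟦𝟘⟧-empty {x = ⟨ α ⟩} t = contradiction (to (⟦⟧ᵇ⇔eval 𝟘 α) t) λ ()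

  -- Solving a continuation by a loop

  module ContinuationSolution (𝒳 𝒴 : Coalgebra) (h : G (State 𝒳 ⊎ State 𝒴))
    (sX : State 𝒳 → Exp) (sX-correct : ∀ x → ℓ 𝒳 x ≐ ⟦ sX x ⟧)
    (sY : State 𝒴 → Exp) (sY-correct : ∀ y → ℓ 𝒴 y ≐ ⟦ sY y ⟧) where

    open Continuation 𝒳 𝒴 h

    private
      entersX : Outcome (State 𝒵) → Bool
      entersX (inj₁ _)            = false
      entersX (inj₂ (_ , inj₁ _)) = true
      entersX (inj₂ (_ , inj₂ _)) = false

      bX : BExp
      bX = charTest (entersX ∘ h)

      -- Denoting the other side by `𝟘` deletes its transitions. Immediate acceptance survives in
      -- both expressions, but the guard `bX` keeps it out of the loop body.
      tX tY : State 𝒵 → Exp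
      tX = [ sX , const (test 𝟘) ]
      tY = [ const (test 𝟘) , sY ]

      bodyX exitY : Exp
      bodyX = pseudostateExp tX h
      exitY = pseudostateExp tY h

    continuationExp : Exp
    continuationExp = bodyX ^⟨ bX ⟩ ∙ exitY

    private
      exit : ∀ {z} → entersX (h (first z)) ≡ false → behaviour (⟦_⟧ ∘ tY) h z →
             ⟦ continuationExp ⟧ z
      exit {z} out b = ◇-intro {x = ⟨ first z ⟩}
        (loop-done {x = ⟨ first z ⟩} λ bα →
          contradiction (≡-trans (≡-sym out) (to (charTest-⇔ _ (first z)) bα)) λ ())
        (proj₂ (⟦pseudostateExp⟧ tY h) b) (here refl)

      -- Acceptance and a move to `𝒴` leave the loop after zero iterations; a move to `𝒳` puts one
      -- more iteration in front.
      closed : behaviour (resume ⟦ continuationExp ⟧) h ⊆ ⟦ continuationExp ⟧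
      closed {⟨ α ⟩} eq = exit {⟨ α ⟩} (cong entersX eq) eq
      closed {α ▸ p ▸ z} (inj₂ y , eq , r) =
        exit (cong entersX eq) (inj₂ y , eq , proj₁ (sY-correct y) r)
      closed {α ▸ p ▸ z} (inj₁ x , eq , r) with _ , _ , a , k , f ← ◇-elim r =
        ◇-mono loop-step id (◇-assocˡ (◇-intro
          (from atoms-◇ (from (charTest-⇔ _ α) (cong entersX eq) ,
            proj₂ (⟦pseudostateExp⟧ tX h) (inj₁ x , eq , proj₁ (sX-correct x) a)))
          k (there f)))

      base : atoms (∁ ⟦ bX ⟧ᵇ) ◇ ⟦ exitY ⟧ ⊆ E
      base r = behaviour-mono tY⊆ℓ𝒵 (proj₁ (⟦pseudostateExp⟧ tY h) (proj₂ (to atoms-◇ r)))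
        where
        tY⊆ℓ𝒵 : ∀ t → ⟦ tY t ⟧ ⊆ ℓ 𝒵 t
        tY⊆ℓ𝒵 (inj₁ x) = ⟦𝟘⟧-empty {ℓ 𝒵 (inj₁ x)}
        tY⊆ℓ𝒵 (inj₂ y) = resume⊆ℓ𝒵 (inj₂ y) ∘ proj₂ (sY-correct y)

      unroll : (atoms ⟦ bX ⟧ᵇ ◇ ⟦ bodyX ⟧) ◇ E ⊆ E
      unroll r with _ , _ , B , Ey , f ← ◇-elim r with bα , body ← to atoms-◇ B
        with f | proj₁ (⟦pseudostateExp⟧ tX h) body
      -- A body consisting of one atom means that `h` accepts there, while `bX` demands a move into
      -- `𝒳`.
      ... | here {α} _ | eq =
        contradiction (≡-trans (≡-sym (to (charTest-⇔ _ α) bα)) (cong entersX eq)) λ ()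
      ... | there f′ | inj₁ x , eq , a =
        inj₁ x , eq , resume⊆ℓ𝒵 (inj₁ x) (◇-intro (proj₂ (sX-correct x) a) Ey f′)
      ... | there {x = w} f′ | inj₂ _ , _ , a = ⟦𝟘⟧-empty {const _} {w} a

    ⟦continuationExp⟧ : E ≐ ⟦ continuationExp ⟧
    ⟦continuationExp⟧ = E-least closed , loop-least base unroll

  -- By induction on the nesting: states of `𝒳` have the common `continuationExp` appended to their
  -- expressions, and states of `𝒴` keep theirs.
  solution : ∀ {𝒳} → WellNested 𝒳 → ∀ s → ∃[ e ] ℓ 𝒳 s ≐ ⟦ e ⟧
  solution {𝒳} (no-transitions stuck) s =
    -- `test 𝟘` is a placeholder for successors, of which there are none.
    pseudostateExp (const (test 𝟘)) (δ 𝒳 s) ,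
    ≐-trans (ℓ-unfold 𝒳 s)
      (≐-trans (terminal , terminal) (≐-sym (⟦pseudostateExp⟧ _ (δ 𝒳 s))))
    where
    terminal : ∀ {S S′ : State 𝒳 → Language} → behaviour S (δ 𝒳 s) ⊆ behaviour S′ (δ 𝒳 s)
    terminal {x = ⟨ _ ⟩}     eq = eq
    terminal {x = α ▸ _ ▸ _} (_ , eq , _) =
      contradiction (≡-trans (≡-sym (proj₂ (stuck s α))) eq) λ ()
  solution (continue {𝒳} {𝒴} wX wY h) = solve
    where
    open Continuation 𝒳 𝒴 h
    okX : ∀ x → ℓ 𝒳 x ≐ ⟦ proj₁ (solution wX x) ⟧
    okX x = proj₂ (solution wX x)
    okY : ∀ y → ℓ 𝒴 y ≐ ⟦ proj₁ (solution wY y) ⟧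
    okY y = proj₂ (solution wY y)
    open ContinuationSolution 𝒳 𝒴 h (proj₁ ∘ solution wX) okX (proj₁ ∘ solution wY) okY
    solve : ∀ s → ∃[ e ] ℓ 𝒵 s ≐ ⟦ e ⟧
    solve (inj₁ x) = proj₁ (solution wX x) ∙ continuationExp ,
      ≐-trans (ℓ𝒵≐resume (inj₁ x)) (◇-cong (okX x) ⟦continuationExp⟧)
    solve (inj₂ y) = proj₁ (solution wY y) ,
      ≐-trans (ℓ𝒵≐resume (inj₂ y)) (okY y)

corollary4p10 : (n : ℕ) → .{{_ : NonZero n}} → (Act : Set) → Act → let open GKAT n Act in
    (L : Language) →
    (∃[ e ] L ≐ ⟦ e ⟧)
    ⇔ (∃[ 𝒳 ] WellNested (coalg 𝒳) × FiniteState (coalg 𝒳) × L ≐ ℓ (coalg 𝒳) (start 𝒳))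
corollary4p10 n Act _ L = mk⇔ toAutomaton toExpression
  where
  open GKAT n Act
  open Kleene n Act
  toAutomaton : ∃[ e ] L ≐ ⟦ e ⟧ →
    ∃[ 𝒳 ] WellNested (coalg 𝒳) × FiniteState (coalg 𝒳) × L ≐ ℓ (coalg 𝒳) (start 𝒳)
  toAutomaton (e , L≐e) with 𝒜 , wn , fin , e≐ℓ ← Realisation⇒automaton (realise e) =
    𝒜 , wn , fin , ≐-trans L≐e e≐ℓ
  toExpression :
    ∃[ 𝒳 ] WellNested (coalg 𝒳) × FiniteState (coalg 𝒳) × L ≐ ℓ (coalg 𝒳) (start 𝒳) →
    ∃[ e ] L ≐ ⟦ e ⟧
  toExpression (𝒜 , wn , _ , L≐ℓ) with e , ℓ≐e ← solution wn (start 𝒜) =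
    e , ≐-trans L≐ℓ ℓ≐e
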